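{- Let $\Sigma$ be an alphabet and $w$ a word over $\Sigma$. If $u$ and $v$ are both primitive generators of $w$, then $u = v$ or $u = \tilde{v}$. (That is, the primitive generator of any word is unique up to reversal.)
   Context: For integers $i,k$, $[i,k]=\{j\in\mathbb{Z} : i\le j\le k\}$. For a word $u=a_1\cdots a_n$ over $\Sigma$ and a function $f\colon[1,m]\to[1,n]$, $u^f$ denotes the word $a_{f(1)}\cdots a_{f(m)}$. A walk is a surjection $f\colon[1,m]\to[1,n]$ with $|f(i+1)-f(i)|\le 1$ for all $1\le i<m$. A word $u$ generates a word $w$ if $w=u^f$ for some walk $f$. The reversal of $u=a_1\cdots a_n$ is $\tilde{u}=a_n\cdots a_1$. A word $u$ is primitive if it is not generated by any word strictly shorter than itself. A primitive generator of $w$ is a primitive word that generates $w$. -}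

module Defs where

open import Data.Nat using (ℕ; _≤_; _<_; suc)
open import Data.Integer using (ℤ; +_; _-_; ∣_∣)
open import Data.Fin using (Fin; toℕ; inject₁)
open import Data.List using (List; length; lookup; tabulate; reverse)
open import Data.Empty using (⊥)
open import Data.Product using (Σ; ∃; _×_)
open import Relation.Binary.PropositionalEquality using (_≡_)
open import Function.Definitions using (Surjective)

-- words over Σ are lists; positions are 0-based (Fin n) instead of [1,n]

_^_ : ∀ {a} {Σ : Set a} (u : List Σ) {m : ℕ} → (Fin m → Fin (length u)) → List Σ
(u ^ f) = tabulate (λ i → lookup u (f i))

Steps : ∀ {m n : ℕ} → (Fin m → Fin n) → Set
Steps {m} f = ∀ (i : Fin m) (j : Fin m) → suc (toℕ i) ≡ toℕ j →
  ∣ (+ toℕ (f j)) - (+ toℕ (f i)) ∣ ≤ 1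

IsWalk : ∀ {m n : ℕ} → (Fin m → Fin n) → Set
IsWalk f = Surjective _≡_ _≡_ f × Steps f

Generates : ∀ {a} {Σ : Set a} → List Σ → List Σ → Set a
Generates u w = Σ ℕ λ m → Σ (Fin m → Fin (length u)) λ f → IsWalk f × (w ≡ u ^ f)

Primitive : ∀ {a} {Σ : Set a} → List Σ → Set a
Primitive {Σ = Σ} u = ∀ (v : List Σ) → length v < length u → Generates v u → ⊥

PrimitiveGenerator : ∀ {a} {Σ : Set a} → List Σ → List Σ → Set a
PrimitiveGenerator u w = Primitive u × Generates u w

{-# OPTIONS --safe #-}

-- Walking along w moves a point (x , y) of the grid of positions of u and v whose letters agree, and
-- the walk visits the first and last positions of both words. Primitivity rules out hesitations of one
-- coordinate alone, so the walk is a sequence of diagonal legs. At a leg of locally minimal length p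
-- with a leg on either side, both words read the same zigzag of three legs. If one coordinate does not
-- turn at either end, its word contains that zigzag as a factor and is not primitive; otherwise the
-- three legs of lengths a, p, b can be replaced by legs of lengths a - p, p, b - p with the same outer
-- ends. A locally minimal first or last leg can be folded onto its neighbour. None of this loses an
-- extreme position, since the word concerned would then have a palindromic prefix or suffix. In the end
-- a single leg remains, which traverses both u and v.

module Submission where

open import Defs
open import Level using (Level)
open import Data.Empty using (⊥; ⊥-elim)
open import Data.Fin.Base using (Fin; zero; suc; toℕ; fromℕ; fromℕ<; cast; inject₁)
open import Data.Fin.Properties using (toℕ<n; toℕ-fromℕ; toℕ-fromℕ<; toℕ-cast; toℕ-injective; toℕ-inject₁)
open import Data.Integer.Base using (ℤ; +_; -[1+_]; ∣_∣) renaming (_+_ to _+ℤ_; _-_ to _-ℤ_)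
open import Data.Integer.Properties using (+-injective; m-n≡m⊖n; ∣⊖∣-≤; ∣m⊖n∣≡∣n⊖m∣)
import Data.Integer.Tactic.RingSolver as ℤ-Solver
open import Data.List using (List; reverse; []; _∷_; length; lookup; tabulate; _++_; [_])
open import Data.List.Properties using (tabulate-cong; tabulate-lookup; length-tabulate; lookup-tabulate; unfold-reverse; length-reverse; reverse-injective; reverse-involutive; ∷-injectiveˡ; ∷-injectiveʳ)
open import Data.Maybe.Base using (Maybe; just; nothing)
open import Data.Maybe.Properties using (just-injective)
open import Data.Nat.Base using (ℕ; zero; suc; _+_; _∸_; _⊓_; _⊔_; _≤_; _<_; z≤n; s≤s; z<s; >-nonZero)
open import Data.Nat.Properties
open import Data.Nat.Tactic.RingSolver using (solve-∀)
open import Data.Product.Base using (Σ; ∃; _×_; _,_; proj₁; proj₂)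
open import Data.Sign.Base as Sign using (Sign; opposite)
open import Data.Sign.Properties using (opposite-involutive)
open import Data.Sum using (_⊎_; inj₁; inj₂; map₂)
open import Function.Base using (id)
open import Function.Definitions using (Surjective)
open import Relation.Binary.PropositionalEquality using (_≡_; refl; sym; trans; cong; cong₂; subst; subst₂; module ≡-Reasoning)

private
  variable
    a : Level
    A : Set a

-- Letters of words at natural-number positions

atℕ : List A → ℕ → Maybe A
atℕ []       _       = nothing
atℕ (x ∷ xs) zero    = just x
atℕ (x ∷ xs) (suc i) = atℕ xs i

atℕ-lookup : (xs : List A) (i : Fin (length xs)) → atℕ xs (toℕ i) ≡ just (lookup xs i)
atℕ-lookup (x ∷ xs) zero    = refl
atℕ-lookup (x ∷ xs) (suc i) = atℕ-lookup xs i

atℕ-≥ : (xs : List A) {i : ℕ} → length xs ≤ i → atℕ xs i ≡ nothing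
atℕ-≥ []       _         = refl
atℕ-≥ (x ∷ xs) (s≤s len≤i) = atℕ-≥ xs len≤i

atℕ-just⇒< : (xs : List A) (i : ℕ) {x : A} → atℕ xs i ≡ just x → i < length xs
atℕ-just⇒< (_ ∷ xs) zero    _  = z<s
atℕ-just⇒< (_ ∷ xs) (suc i) eq = s≤s (atℕ-just⇒< xs i eq)

atℕ-nothing⇒≥ : (xs : List A) (i : ℕ) → atℕ xs i ≡ nothing → length xs ≤ i
atℕ-nothing⇒≥ []       i       _  = z≤n
atℕ-nothing⇒≥ (_ ∷ xs) (suc i) eq = s≤s (atℕ-nothing⇒≥ xs i eq)

-- Walks as 1-Lipschitz functions

Lipschitz : (ℕ → ℕ) → Set
Lipschitz h = ∀ i → h (suc i) ≤ suc (h i) × h i ≤ suc (h (suc i))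

lip-id : Lipschitz (λ i → i)
lip-id i = ≤-refl , m≤n⇒m≤1+n (n≤1+n i)

lip-const : ∀ c → Lipschitz (λ _ → c)
lip-const c i = n≤1+n c , n≤1+n c

-- The folding maps below are maxima and minima of the identity, constants and truncated
-- differences, so these closure properties make each of them a walk.
lip-⊔ : ∀ {f g} → Lipschitz f → Lipschitz g → Lipschitz (λ i → f i ⊔ g i)
lip-⊔ F G i = ⊔-mono-≤ (proj₁ (F i)) (proj₁ (G i)) , ⊔-mono-≤ (proj₂ (F i)) (proj₂ (G i))

lip-⊓ : ∀ {f g} → Lipschitz f → Lipschitz g → Lipschitz (λ i → f i ⊓ g i)
lip-⊓ F G i = ⊓-mono-≤ (proj₁ (F i)) (proj₁ (G i)) , ⊓-mono-≤ (proj₂ (F i)) (proj₂ (G i))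

lip-∸ˡ : ∀ c → Lipschitz (_∸ c)
lip-∸ˡ zero    = lip-id
lip-∸ˡ (suc c) zero = subst (_≤ suc (0 ∸ suc c)) (sym (0∸n≡0 c)) z≤n , z≤n
lip-∸ˡ (suc c) (suc i) = lip-∸ˡ c i

lip-∸ʳ : ∀ c → Lipschitz (c ∸_)
lip-∸ʳ zero    i       = z≤n , subst (_≤ suc (0 ∸ suc i)) (sym (0∸n≡0 i)) z≤n
lip-∸ʳ (suc c) zero    = m≤n⇒m≤1+n (n≤1+n c) , ≤-refl
lip-∸ʳ (suc c) (suc i) = lip-∸ʳ c i

∣m-n∣≤1 : ∀ {m n} → m ≤ suc n → n ≤ suc m → ∣ + m -ℤ + n ∣ ≤ 1
∣m-n∣≤1 {m} {n} m≤ n≤ rewrite m-n≡m⊖n m n with ≤-total m n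
... | inj₁ m≤n rewrite ∣⊖∣-≤ m≤n = ≤-trans (∸-monoˡ-≤ m n≤) (≤-reflexive (m+n∸n≡m 1 m))
... | inj₂ n≤m rewrite ∣m⊖n∣≡∣n⊖m∣ m n | ∣⊖∣-≤ n≤m = ≤-trans (∸-monoˡ-≤ n m≤) (≤-reflexive (m+n∸n≡m 1 n))

-- e is a section of the walk h; the shorter generator is u ∘ e.
collapse : (u : List A) → Primitive u → {n l : ℕ} → length u ≡ n → l < n → (e h : ℕ → ℕ) →
           (∀ {j} → j < l → e j < n) → (∀ {i} → i < n → h i < l) → Lipschitz h →
           (∀ {j} → j < l → h (e j) ≡ j) → (∀ {i} → i < n → atℕ u (e (h i)) ≡ atℕ u i) → ⊥
collapse {A = A} u prim {l = l} refl l<n e h e< h< lip he≡ uehi≡ =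
  prim v (subst (_< length u) (sym |v|) l<n)
    (length u , f , (surj , steps) , trans (sym (tabulate-lookup u)) (tabulate-cong letters))
  where
  e′ : Fin l → Fin (length u)
  e′ j = fromℕ< (e< (toℕ<n j))

  v : List A
  v = tabulate (λ j → lookup u (e′ j))

  |v| : length v ≡ l
  |v| = length-tabulate (λ j → lookup u (e′ j))

  h′ : Fin (length u) → Fin l
  h′ i = fromℕ< (h< (toℕ<n i))

  f : Fin (length u) → Fin (length v)
  f i = cast (sym |v|) (h′ i)

  toℕ-f : ∀ i → toℕ (f i) ≡ h (toℕ i)
  toℕ-f i = trans (toℕ-cast (sym |v|) (h′ i)) (toℕ-fromℕ< _)

  surj : ∀ y → ∃ λ x → ∀ {z} → z ≡ x → f z ≡ y
  surj y = fromℕ< (e< y<l) , λ { refl → toℕ-injective (trans (toℕ-f _) (trans (cong h (toℕ-fromℕ< _)) (he≡ y<l))) }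
    where
    y<l : toℕ y < l
    y<l = subst (toℕ y <_) |v| (toℕ<n y)

  steps : Steps f
  steps i j i+1≡j rewrite toℕ-f i | toℕ-f j | sym i+1≡j = ∣m-n∣≤1 (proj₁ (lip (toℕ i))) (proj₂ (lip (toℕ i)))

  letters : ∀ i → lookup u i ≡ lookup v (f i)
  letters i = just-injective (begin
    just (lookup u i)                  ≡⟨ atℕ-lookup u i ⟨
    atℕ u (toℕ i)                      ≡⟨ uehi≡ (toℕ<n i) ⟨
    atℕ u (e (h (toℕ i)))              ≡⟨ cong (λ k → atℕ u (e k)) (toℕ-fromℕ< _) ⟨
    atℕ u (e (toℕ (h′ i)))             ≡⟨ cong (atℕ u) (toℕ-fromℕ< _) ⟨
    atℕ u (toℕ (e′ (h′ i)))            ≡⟨ atℕ-lookup u (e′ (h′ i)) ⟩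
    just (lookup u (e′ (h′ i)))        ≡⟨ cong just (lookup-tabulate (λ j → lookup u (e′ j)) (h′ i)) ⟨
    just (lookup v (f i))              ∎)
    where open ≡-Reasoning

-- The difference is returned as a witness, so that matching on `refl` rewrites positions as sums.
split : ∀ c i → (∃ λ k → c ≡ i + k) ⊎ (∃ λ k → i ≡ suc (c + k))
split zero    zero    = inj₁ (0 , refl)
split zero    (suc i) = inj₂ (i , refl)
split (suc c) zero    = inj₁ (suc c , refl)
split (suc c) (suc i) with split c i
... | inj₁ (k , eq) = inj₁ (k , cong suc eq)
... | inj₂ (k , eq) = inj₂ (k , cong suc eq)

-- Factors excluded by primitivity

-- x is the left end, x + p the centre.
PalindromeAt : List A → ℕ → ℕ → Set _
PalindromeAt u x p = ∀ i j → i + j ≡ p + p → atℕ u (x + i) ≡ atℕ u (x + j)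

-- The map `i ↦ |i - p|` folds the first half of the palindrome onto the second, so the suffix
-- starting at `p` already generates `u`.
no-prefix-palindromeℕ : (u : List A) → Primitive u → ∀ p → 1 ≤ p → p + p < length u → PalindromeAt u 0 p → ⊥
no-prefix-palindromeℕ u prim p 1≤p 2p<n pal with m≤n⇒∃[o]m+o≡n (<⇒≤ (≤-<-trans (m≤m+n p p) 2p<n))
... | l , n≡ = collapse u prim (sym n≡) (m<n+m l 1≤p) (λ j → p + j) (λ i → (p ∸ i) ⊔ (i ∸ p))
    (+-monoʳ-< p) h< (lip-⊔ (lip-∸ʳ p) (lip-∸ˡ p)) he letters
  where
  h< : ∀ {i} → i < p + l → (p ∸ i) ⊔ (i ∸ p) < l
  h< {i} i<n = ⊔-pres-<m (≤-<-trans (m∸n≤m p i) p<l) (m<n+o⇒m∸n<o i p {{>-nonZero (≤-<-trans z≤n p<l)}} i<n)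
    where
    p<l : p < l
    p<l = +-cancelˡ-< p p l (subst (p + p <_) (sym n≡) 2p<n)
  he : ∀ {j} → j < l → (p ∸ (p + j)) ⊔ ((p + j) ∸ p) ≡ j
  he {j} _ rewrite m≤n⇒m∸n≡0 (m≤m+n p j) = m+n∸m≡n p j
  letters : ∀ {i} → i < p + l → atℕ u (p + ((p ∸ i) ⊔ (i ∸ p))) ≡ atℕ u i
  letters {i} _ with ≤-total p i
  ... | inj₁ p≤i rewrite m≤n⇒m∸n≡0 p≤i = cong (atℕ u) (m+[n∸m]≡n p≤i)
  ... | inj₂ i≤p rewrite m≤n⇒m∸n≡0 i≤p | ⊔-identityʳ (p ∸ i) =
    pal _ i (trans (+-assoc p (p ∸ i) i) (cong (λ k → p + k) (m∸n+n≡m i≤p)))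

-- With `p = k + j`, reflection in `c = x + p` sends `c + k` to `x + j`; `reflect-shift` shows that
-- the latter is the smaller of the two.
reflect-sum : ∀ x j k → (x + (k + j)) + (x + (k + j)) ≡ (x + (k + j) + k) + (x + j)
reflect-sum = solve-∀

reflect-shift : ∀ x j k → x + (k + j) + k ≡ (x + j) + (k + k)
reflect-shift = solve-∀

-- Folding at the centre `c = x + p` by `i ↦ min (i, 2c - i)` leaves the prefix that ends at `c`,
-- which generates `u`.
no-suffix-palindromeℕ : (u : List A) → Primitive u → ∀ x p → 1 ≤ p → length u ≡ suc (x + (p + p)) → PalindromeAt u x p → ⊥
no-suffix-palindromeℕ u prim x p 1≤p n≡ pal =
  collapse u prim n≡ (s≤s c<n) (λ j → j) (λ i → i ⊓ (c + c ∸ i)) (λ j<l → ≤-trans j<l (s≤s (<⇒≤ c<n)))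
    (λ {i} _ → s≤s (h≤ i)) (lip-⊓ lip-id (lip-∸ʳ (c + c))) he letters
  where
  c = x + p
  c<n : c < x + (p + p)
  c<n = +-monoʳ-< x (m<m+n p 1≤p)
  h≤ : ∀ i → i ⊓ (c + c ∸ i) ≤ c
  h≤ i with ≤-total i c
  ... | inj₁ i≤c = ≤-trans (m⊓n≤m i _) i≤c
  ... | inj₂ c≤i = ≤-trans (m⊓n≤n i _) (≤-trans (∸-monoʳ-≤ (c + c) c≤i) (≤-reflexive (m+n∸n≡m c c)))
  low : ∀ {i} → i ≤ c → i ⊓ (c + c ∸ i) ≡ i
  low {i} i≤c = m≤n⇒m⊓n≡m (≤-trans i≤c (≤-trans (≤-reflexive (sym (m+n∸n≡m c c))) (∸-monoʳ-≤ (c + c) i≤c)))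
  he : ∀ {j} → j < suc c → j ⊓ (c + c ∸ j) ≡ j
  he (s≤s j≤c) = low j≤c
  letters : ∀ {i} → i < suc (x + (p + p)) → atℕ u (i ⊓ (c + c ∸ i)) ≡ atℕ u i
  letters {i} (s≤s i≤) with ≤-total i c
  ... | inj₁ i≤c = cong (atℕ u) (low i≤c)
  ... | inj₂ c≤i with m≤n⇒∃[o]m+o≡n c≤i
  ... | k , refl with m≤n⇒∃[o]m+o≡n {k} {p} (+-cancelˡ-≤ c k p (subst (c + k ≤_) (sym (+-assoc x p p)) i≤))
  ... | j , refl = trans (cong (atℕ u) value) (trans (pal j (k + j + k) (arith j k)) (cong (atℕ u) (sym (+-assoc x (k + j) k))))
    where
    arith : ∀ j k → j + (k + j + k) ≡ (k + j) + (k + j)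
    arith = solve-∀
    value : (x + (k + j) + k) ⊓ ((x + (k + j)) + (x + (k + j)) ∸ (x + (k + j) + k)) ≡ x + j
    value rewrite reflect-sum x j k | m+n∸m≡n (x + (k + j) + k) (x + j) | reflect-shift x j k = m≥n⇒m⊓n≡n (m≤m+n (x + j) (k + k))

-- Enumerates ℕ without the d numbers that follow c.
excise : ℕ → ℕ → ℕ → ℕ
excise c d j with split c j
... | inj₁ _ = j
... | inj₂ _ = j + d

excise-≤ : ∀ {c j} d → j ≤ c → excise c d j ≡ j
excise-≤ {c} {j} d j≤c with split c j
... | inj₁ _ = refl
... | inj₂ (k , refl) = ⊥-elim (<⇒≱ (s≤s (m≤m+n c k)) j≤c)

excise-> : ∀ {c j} d → c < j → excise c d j ≡ j + d
excise-> {c} {j} d c<j with split c j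
... | inj₁ (k , refl) = ⊥-elim (<⇒≱ c<j (m≤m+n j k))
... | inj₂ _ = refl

excise-< : ∀ c {l} d j → j < l → excise c d j < l + d
excise-< c {l} d j j<l with split c j
... | inj₁ _ = ≤-trans j<l (m≤m+n l d)
... | inj₂ _ = +-monoˡ-< d j<l

-- The letter at `x + 1` can be deleted: the walk `h` is the identity up to `x` and `i - 1` beyond,
-- so it merely pauses at `x`.
no-repeatℕ : (u : List A) → Primitive u → ∀ x → suc x < length u → atℕ u x ≡ atℕ u (suc x) → ⊥
no-repeatℕ u prim x x+1<n rep with m≤n⇒∃[o]m+o≡n x+1<n
... | r , n≡ = collapse u prim (trans (sym n≡) (+-comm 1 _)) (m<m+n _ z<s) (excise x 1) h
    (λ {j} → excise-< x 1 j) h< (lip-⊔ (lip-⊓ lip-id (lip-const x)) (lip-∸ˡ 1)) he letters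
  where
  l = suc x + r
  h : ℕ → ℕ
  h i = (i ⊓ x) ⊔ (i ∸ 1)
  low : ∀ {i} → i ≤ x → h i ≡ i
  low {i} i≤x rewrite m≤n⇒m⊓n≡m i≤x = m≥n⇒m⊔n≡m (m∸n≤m i 1)
  high : ∀ k → h (suc (x + k)) ≡ x + k
  high k rewrite m≥n⇒m⊓n≡n {suc (x + k)} {x} (m≤n⇒m≤1+n (m≤m+n x k)) = m≤n⇒m⊔n≡n (m≤m+n x k)
  h< : ∀ {i} → i < l + 1 → h i < l
  h< {i} i<n with split x i
  ... | inj₁ (k , refl) rewrite low (m≤m+n i k) = s≤s (≤-trans (m≤m+n i k) (m≤m+n (i + k) r))
  ... | inj₂ (k , refl) rewrite high k = +-cancelʳ-< 1 _ l (subst (_< l + 1) (+-comm 1 (x + k)) i<n)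
  he : ∀ {j} → j < l → h (excise x 1 j) ≡ j
  he {j} _ with split x j
  ... | inj₁ (k , refl) = low (m≤m+n j k)
  ... | inj₂ (k , refl) rewrite +-assoc x k 1 = trans (high (k + 1)) (trans (sym (+-assoc x k 1)) (+-comm (x + k) 1))
  letters : ∀ {i} → i < l + 1 → atℕ u (excise x 1 (h i)) ≡ atℕ u i
  letters {i} _ with split x i
  ... | inj₁ (k , refl) rewrite low (m≤m+n i k) | excise-≤ 1 (m≤m+n i k) = refl
  ... | inj₂ (zero , refl) rewrite high 0 | +-identityʳ x | excise-≤ 1 (≤-refl {x}) = rep
  ... | inj₂ (suc k , refl) rewrite high (suc k) | excise-> {x} {x + suc k} 1 (m<m+n x z<s) = cong (atℕ u) (+-comm (x + suc k) 1)

-- The factor is a zigzag of three legs of length p, turning at x + p and x + 2p.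
no-zigzagℕ : (u : List A) → Primitive u → ∀ x p → 1 ≤ p → x + (p + (p + p)) < length u →
             PalindromeAt u x p → PalindromeAt u (x + p) p → ⊥
no-zigzagℕ u prim x p 1≤p x+3p<n pal₁ pal₂ with m≤n⇒∃[o]m+o≡n x+3p<n
... | r , n≡ = collapse u prim (trans (sym n≡) (arith x p r)) (m<m+n l (≤-trans 1≤p (m≤m+n p p))) (excise c (p + p)) h
    (λ {j} → excise-< c (p + p) j) h< (lip-⊔ (lip-⊓ lip-id (lip-∸ʳ (c + c))) (lip-∸ˡ (p + p))) he letters
  where
  arith : ∀ x p r → suc (x + (p + (p + p))) + r ≡ suc (x + p) + r + (p + p)
  arith = solve-∀
  c = x + p
  l = suc c + r
  -- `h` climbs to `c`, descends to `x` by reflection in `c`, and climbs again as `i - 2p` from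
  -- `x + 2p` on. The `p + p` positions after `c` are cut out.
  h : ℕ → ℕ
  h i = (i ⊓ (c + c ∸ i)) ⊔ (i ∸ (p + p))
  low : ∀ {i} → i ≤ c → h i ≡ i
  low {i} i≤c rewrite m≤n⇒m⊓n≡m {i} {c + c ∸ i} (≤-trans i≤c (≤-trans (≤-reflexive (sym (m+n∸n≡m c c))) (∸-monoʳ-≤ (c + c) i≤c))) =
    m≥n⇒m⊔n≡m (m∸n≤m i (p + p))
  mid : ∀ k j → k + j ≡ p → h (c + k) ≡ x + j
  mid k j refl rewrite reflect-sum x j k | m+n∸m≡n (x + (k + j) + k) (x + j) | reflect-shift x j k
                     | m≥n⇒m⊓n≡n (m≤m+n (x + j) (k + k)) = m≥n⇒m⊔n≡m bound
    where
    bound : x + j + (k + k) ∸ (k + j + (k + j)) ≤ x + j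
    bound = ≤-trans (∸-monoʳ-≤ (x + j + (k + k)) (+-mono-≤ (m≤m+n k j) (m≤m+n k j))) (≤-reflexive (m+n∸n≡m (x + j) (k + k)))
  high : ∀ k → h (x + k + (p + p)) ≡ x + k
  high k rewrite m+n∸n≡m (x + k) (p + p) = m≤n⇒m⊔n≡n (≤-trans (m⊓n≤n (x + k + (p + p)) _) bound)
    where
    arith₂ : ∀ x p → (x + p) + (x + p) ≡ x + (x + (p + p))
    arith₂ = solve-∀
    bound : c + c ∸ (x + k + (p + p)) ≤ x + k
    bound = ≤-trans (∸-monoʳ-≤ (c + c) (+-monoˡ-≤ (p + p) (m≤m+n x k)))
              (≤-trans (≤-reflexive (trans (cong (_∸ (x + (p + p))) (arith₂ x p)) (m+n∸n≡m x (x + (p + p))))) (m≤m+n x k))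
  data Part : ℕ → Set where
    first  : ∀ {i} → i ≤ c → Part i
    second : ∀ k j → k + j ≡ p → Part (c + k)
    third  : ∀ k → Part (x + k + (p + p))
  part : ∀ i → Part i
  part i with ≤-total i c
  ... | inj₁ i≤c = first i≤c
  ... | inj₂ c≤i with m≤n⇒∃[o]m+o≡n c≤i
  ... | k , refl with ≤-total k p
  ... | inj₁ k≤p = second k (p ∸ k) (m+[n∸m]≡n k≤p)
  ... | inj₂ p≤k with m≤n⇒∃[o]m+o≡n p≤k
  ... | j , refl = subst Part (arith₂ x j p) (third j)
    where
    arith₂ : ∀ x j p → x + j + (p + p) ≡ x + p + (p + j)
    arith₂ = solve-∀
  h< : ∀ {i} → i < l + (p + p) → h i < l
  h< {i} i<n with part i
  ... | first i≤c rewrite low i≤c = s≤s (≤-trans i≤c (m≤m+n c r))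
  ... | second k j k+j≡p rewrite mid k j k+j≡p =
    s≤s (≤-trans (+-monoʳ-≤ x (subst (j ≤_) k+j≡p (m≤n+m j k))) (m≤m+n c r))
  ... | third k rewrite high k = +-cancelʳ-< (p + p) _ l i<n
  he : ∀ {j} → j < l → h (excise c (p + p) j) ≡ j
  he {j} _ with split c j
  ... | inj₁ (k , c≡) = low (subst (j ≤_) (sym c≡) (m≤m+n j k))
  ... | inj₂ (k , refl) = trans (cong h (cong (_+ (p + p)) (sym (arith₃ x p k)))) (trans (high (suc (p + k))) (arith₃ x p k))
    where
    arith₃ : ∀ x p k → x + suc (p + k) ≡ suc (x + p + k)
    arith₃ = solve-∀
  letters : ∀ {i} → i < l + (p + p) → atℕ u (excise c (p + p) (h i)) ≡ atℕ u i
  letters {i} _ with part i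
  ... | first i≤c rewrite low i≤c | excise-≤ (p + p) i≤c = refl
  ... | second k j k+j≡p rewrite mid k j k+j≡p | excise-≤ {c} {x + j} (p + p) (+-monoʳ-≤ x (subst (j ≤_) k+j≡p (m≤n+m j k))) =
    trans (pal₁ j (p + k) (arith₂ k+j≡p)) (cong (atℕ u) (sym (+-assoc x p k)))
    where
    arith₃ : ∀ j k → j + (k + j + k) ≡ k + j + (k + j)
    arith₃ = solve-∀
    arith₂ : k + j ≡ p → j + (p + k) ≡ p + p
    arith₂ refl = arith₃ j k
  ... | third k rewrite high k with ≤-total k p
  ...   | inj₁ k≤p rewrite excise-≤ {c} {x + k} (p + p) (+-monoʳ-≤ x k≤p) with m≤n⇒∃[o]m+o≡n k≤p
  -- The letter at `x + k` on the first leg is carried by `pal₁` to the second leg and from there by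
  -- `pal₂` to the third.
  ...     | j , refl = trans (pal₁ k (k + j + j) (arith₂ k j))
              (trans (cong (atℕ u) (sym (+-assoc x (k + j) j))) (trans (pal₂ j (k + (k + j)) (arith₃ k j)) (cong (atℕ u) (arith₄ x k j))))
    where
    arith₂ : ∀ k j → k + (k + j + j) ≡ k + j + (k + j)
    arith₂ = solve-∀
    arith₃ : ∀ k j → j + (k + (k + j)) ≡ k + j + (k + j)
    arith₃ = solve-∀
    arith₄ : ∀ x k j → x + (k + j) + (k + (k + j)) ≡ x + k + (k + j + (k + j))
    arith₄ = solve-∀
  letters {i} _ | third k | inj₂ p≤k with m≤n⇒m<n∨m≡n p≤k
  ... | inj₁ p<k rewrite excise-> {c} {x + k} (p + p) (+-monoʳ-< x p<k) = refl
  -- `excise` keeps the position `c` itself, so the last letter of the third leg is read at `c`; the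
  -- second palindrome links its two ends.
  ... | inj₂ refl rewrite excise-≤ {c} {x + k} (p + p) ≤-refl =
    trans (cong (atℕ u) (sym (+-identityʳ (x + p)))) (pal₂ 0 (p + p) refl)

-- Reflections of positions, indexed by ℤ

-- Over the integers every move can be undone without a bound, and leaving the word at either end is
-- the same equation with `nothing`.
at : List A → ℤ → Maybe A
at xs (+ i)    = atℕ xs i
at xs -[1+ _ ] = nothing

infixl 6 _⟨_⟩_

_⟨_⟩_ : ℤ → Sign → ℕ → ℤ
x ⟨ Sign.+ ⟩ i = x +ℤ + i
x ⟨ Sign.- ⟩ i = x -ℤ + i

move-0 : ∀ x s → x ⟨ s ⟩ 0 ≡ x
move-0 x Sign.+ = identity x
  where
  identity : ∀ x → x +ℤ + 0 ≡ x
  identity = ℤ-Solver.solve-∀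
move-0 x Sign.- = identity x
  where
  identity : ∀ x → x -ℤ + 0 ≡ x
  identity = ℤ-Solver.solve-∀

move-+ : ∀ x s i j → x ⟨ s ⟩ (i + j) ≡ x ⟨ s ⟩ i ⟨ s ⟩ j
move-+ x Sign.+ i j = assoc x (+ i) (+ j)
  where
  assoc : ∀ x i j → x +ℤ (i +ℤ j) ≡ x +ℤ i +ℤ j
  assoc = ℤ-Solver.solve-∀
move-+ x Sign.- i j = assoc x (+ i) (+ j)
  where
  assoc : ∀ x i j → x -ℤ (i +ℤ j) ≡ x -ℤ i -ℤ j
  assoc = ℤ-Solver.solve-∀

move-back : ∀ x s i → x ⟨ s ⟩ i ⟨ opposite s ⟩ i ≡ x
move-back x Sign.+ i = cancel x (+ i)
  where
  cancel : ∀ x i → x +ℤ i -ℤ i ≡ x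
  cancel = ℤ-Solver.solve-∀
move-back x Sign.- i = cancel x (+ i)
  where
  cancel : ∀ x i → x -ℤ i +ℤ i ≡ x
  cancel = ℤ-Solver.solve-∀

move-forth : ∀ x s i → x ⟨ opposite s ⟩ i ⟨ s ⟩ i ≡ x
move-forth x Sign.+ = move-back x Sign.-
move-forth x Sign.- = move-back x Sign.+

move-back-+ : ∀ x s i j → x ⟨ s ⟩ (i + j) ⟨ opposite s ⟩ j ≡ x ⟨ s ⟩ i
move-back-+ x s i j = trans (cong (_⟨ opposite s ⟩ j) (move-+ x s i j)) (move-back (x ⟨ s ⟩ i) s j)

same-or-opposite : ∀ s t → t ≡ s ⊎ t ≡ opposite s
same-or-opposite Sign.+ Sign.+ = inj₁ refl
same-or-opposite Sign.+ Sign.- = inj₂ refl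
same-or-opposite Sign.- Sign.+ = inj₂ refl
same-or-opposite Sign.- Sign.- = inj₁ refl

just≢nothing : {x : Maybe A} {y : A} → x ≡ just y → x ≡ nothing → ⊥
just≢nothing refl ()

at-just⇒ℕ : (w : List A) (x : ℤ) {l : A} → at w x ≡ just l → ∃ λ i → x ≡ + i × i < length w
at-just⇒ℕ w (+ i) eq = i , refl , atℕ-just⇒< w i eq

-- For opposite directions this is a palindrome of radius `p` around `c`; for equal ones it only
-- says that the positions lie in the word. A coordinate that runs straight on and one that turns
-- are thus treated alike.
record Mirror {A : Set a} (w : List A) (c : ℤ) (r₁ r₂ : Sign) (p : ℕ) : Set a where
  constructor mirror
  field reflect : ∀ i → i ≤ p → ∃ λ l → at w (c ⟨ r₁ ⟩ i) ≡ just l × at w (c ⟨ r₂ ⟩ i) ≡ just l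

open Mirror

mirror-sym : ∀ {w : List A} {c r₁ r₂ p} → Mirror w c r₁ r₂ p → Mirror w c r₂ r₁ p
mirror-sym m = mirror λ i i≤p → let l , e₁ , e₂ = reflect m i i≤p in l , e₂ , e₁

mirror⇒palindrome : ∀ (w : List A) c p → Mirror w c Sign.- Sign.+ p →
                    ∃ λ x → c ≡ + (x + p) × x + (p + p) < length w × PalindromeAt w x p
mirror⇒palindrome w c p m with reflect m p ≤-refl
... | l , left , right with at-just⇒ℕ w (c ⟨ Sign.- ⟩ p) left
... | x , c-p≡x , _ = x , c≡ , bound , pal
  where
  c≡ : c ≡ + (x + p)
  c≡ = trans (sym (move-forth c Sign.+ p)) (cong (_⟨ Sign.+ ⟩ p) c-p≡x)
  bound : x + (p + p) < length w
  bound = atℕ-just⇒< w _ (subst (λ z → at w z ≡ just l) (trans (cong (_⟨ Sign.+ ⟩ p) c≡) (cong +_ (+-assoc x p p))) right)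
  half : ∀ i j → i + j ≡ p + p → i ≤ p → atℕ w (x + i) ≡ atℕ w (x + j)
  half i j i+j≡2p i≤p with m≤n⇒∃[o]m+o≡n i≤p
  ... | k , refl with reflect m k (m≤n+m k i)
  ... | _ , e₁ , e₂ = trans (trans (cong (at w) (sym lower)) e₁) (sym (trans (cong (at w) (sym upper)) e₂))
    where
    lower : c ⟨ Sign.- ⟩ k ≡ + (x + i)
    lower = trans (cong (_⟨ Sign.- ⟩ k) c≡) (trans (cong (λ z → + z ⟨ Sign.- ⟩ k) (sym (+-assoc x i k))) (move-back (+ (x + i)) Sign.+ k))
    upper : c ⟨ Sign.+ ⟩ k ≡ + (x + j)
    upper = trans (cong (_⟨ Sign.+ ⟩ k) c≡)
      (cong +_ (trans (+-assoc x (i + k) k) (cong (λ z → x + z) (sym (+-cancelˡ-≡ i _ _ (trans i+j≡2p (arith i k)))))))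
      where
      arith : ∀ i k → i + k + (i + k) ≡ i + (i + k + k)
      arith = solve-∀
  pal : PalindromeAt w x p
  pal i j i+j≡2p with ≤-total i p
  ... | inj₁ i≤p = half i j i+j≡2p i≤p
  ... | inj₂ p≤i = sym (half j i (trans (+-comm j i) i+j≡2p)
      (+-cancelˡ-≤ p j p (≤-trans (+-monoˡ-≤ j p≤i) (≤-reflexive i+j≡2p))))

-- Mirrors in a primitive word

module _ (w : List A) (prim : Primitive w) where

  no-repeat : ∀ x s {l} → at w x ≡ just l → at w (x ⟨ s ⟩ 1) ≡ just l → ⊥
  no-repeat x Sign.+ e₁ e₂ with at-just⇒ℕ w x e₁
  ... | i , refl , _ rewrite +-comm i 1 = no-repeatℕ w prim i (atℕ-just⇒< w (suc i) e₂) (trans e₁ (sym e₂))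
  no-repeat x Sign.- e₁ e₂ = no-repeat (x ⟨ Sign.- ⟩ 1) Sign.+ e₂ (trans (cong (at w) (move-back x Sign.- 1)) e₁)

  no-end-palindrome : ∀ c s p → 1 ≤ p → Mirror w c (opposite s) s p → at w (c ⟨ s ⟩ p ⟨ s ⟩ 1) ≡ nothing → ⊥
  no-end-palindrome c Sign.+ p 1≤p m end with mirror⇒palindrome w c p m
  ... | x , refl , bound , pal = no-suffix-palindromeℕ w prim x p 1≤p (≤-antisym len≤ bound) pal
    where
    arith : ∀ x p → x + p + p + 1 ≡ suc (x + (p + p))
    arith = solve-∀
    len≤ : length w ≤ suc (x + (p + p))
    len≤ = subst (length w ≤_) (arith x p) (atℕ-nothing⇒≥ w _ end)
  no-end-palindrome c Sign.- p 1≤p m end with mirror⇒palindrome w c p (mirror-sym m)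
  ... | zero  , refl , bound , pal = no-prefix-palindromeℕ w prim p 1≤p bound pal
  ... | suc x , refl , bound , pal = <⇒≱ (≤-trans (s≤s (m≤n⇒m≤1+n (m≤m+n x (p + p)))) bound) (atℕ-nothing⇒≥ w x (subst (λ z → at w z ≡ nothing) pos end))
    where
    pos : + (suc x + p) ⟨ Sign.- ⟩ p ⟨ Sign.- ⟩ 1 ≡ + x
    pos = trans (cong (_⟨ Sign.- ⟩ 1) (move-back (+ suc x) Sign.+ p)) refl

  no-zigzag : ∀ c s p → 1 ≤ p → Mirror w c (opposite s) s p → Mirror w (c ⟨ s ⟩ p) (opposite s) s p → ⊥
  no-zigzag c Sign.+ p 1≤p m₁ m₂ with mirror⇒palindrome w c p m₁ | mirror⇒palindrome w _ p m₂
  ... | x , refl , _ , pal₁ | x′ , eq , bound , pal₂ with +-cancelʳ-≡ p (x + p) x′ (+-injective eq)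
  ... | refl = no-zigzagℕ w prim x p 1≤p (subst (_< length w) (+-assoc x p (p + p)) bound) pal₁ pal₂
  -- Read from the other end, the second centre comes first.
  no-zigzag c Sign.- p 1≤p m₁ m₂ = no-zigzag (c ⟨ Sign.- ⟩ p) Sign.+ p 1≤p (mirror-sym m₂)
    (subst (λ z → Mirror w z Sign.- Sign.+ p) (sym (move-back c Sign.- p)) (mirror-sym m₁))

  -- The word cannot end at the border of a genuine palindrome: outwards primitivity forbids it,
  -- inwards there is the letter one step nearer the centre. So the two directions agree. This is
  -- why no move below loses an extreme position.
  mirror-end : ∀ c r₁ r₂ p → 1 ≤ p → Mirror w c r₁ r₂ p → ∀ ρ →
               at w (c ⟨ r₁ ⟩ p ⟨ ρ ⟩ 1) ≡ nothing → at w (c ⟨ r₂ ⟩ p ⟨ ρ ⟩ 1) ≡ nothing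
  mirror-end c r₁ r₂ (suc p) 1≤p m ρ end with same-or-opposite r₂ r₁
  ... | inj₁ refl = end
  ... | inj₂ refl with same-or-opposite (opposite r₂) ρ
  ...   | inj₁ refl = ⊥-elim (no-end-palindrome c (opposite r₂) (suc p) 1≤p (subst (λ s → Mirror w c s (opposite r₂) (suc p)) (sym (opposite-involutive r₂)) (mirror-sym m)) end)
  ...   | inj₂ refl  = ⊥-elim (just≢nothing (proj₁ (proj₂ (reflect m p (n≤1+n p)))) (trans (cong (at w) (sym pos)) end))
    where
    pos : c ⟨ opposite r₂ ⟩ suc p ⟨ opposite (opposite r₂) ⟩ 1 ≡ c ⟨ opposite r₂ ⟩ p
    pos = trans (cong (λ n → c ⟨ opposite r₂ ⟩ n ⟨ opposite (opposite r₂) ⟩ 1) (+-comm 1 p)) (move-back-+ c (opposite r₂) p 1)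

  -- One coordinate of the shortcut that replaces the three legs of directions s₁, s₂, s₃ around the leg from c to d.
  bridge : ∀ c d s₁ s₂ s₃ p → 1 ≤ p → d ≡ c ⟨ s₂ ⟩ p →
           Mirror w c (opposite s₁) s₂ p → Mirror w d (opposite s₂) s₃ p →
           ∃ λ s → d ⟨ s₃ ⟩ p ≡ c ⟨ opposite s₁ ⟩ p ⟨ s ⟩ p ×
             (∀ i → i ≤ p → at w (c ⟨ opposite s₁ ⟩ p ⟨ s ⟩ i) ≡ at w (c ⟨ opposite s₁ ⟩ p ⟨ s₁ ⟩ i))
  bridge c d s₁ s₂ s₃ p 1≤p refl m₁ m₂ with same-or-opposite s₂ s₃
  -- A coordinate that turns at `d` comes back to `c`; its shortcut repeats the last `p` steps of
  -- the first leg.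
  ... | inj₂ refl  = s₁ , trans (move-back c s₂ p) (sym (move-forth c s₁ p)) , λ _ _ → refl
  ... | inj₁ refl with same-or-opposite s₁ s₂
  ...   | inj₁ refl = ⊥-elim (no-zigzag c s₁ p 1≤p m₁ m₂)
  -- A coordinate that turns at `c` only has its shortcut start at `d` and run along the third leg,
  -- where `m₂` gives the letters of the way back to `c`.
  ...   | inj₂ refl  = opposite s₁ , refl , letters
    where
    letters : ∀ i → i ≤ p → at w (c ⟨ opposite s₁ ⟩ p ⟨ opposite s₁ ⟩ i) ≡ at w (c ⟨ opposite s₁ ⟩ p ⟨ s₁ ⟩ i)
    letters i i≤p with reflect m₂ i i≤p
    ... | _ , e₁ , e₂ = trans e₂ (sym (subst (λ s → at w (c ⟨ opposite s₁ ⟩ p ⟨ s ⟩ i) ≡ _) (opposite-involutive s₁) e₁))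

-- Paths in the grid

module Grid {A : Set a} (u v : List A) (primᵘ : Primitive u) (primᵛ : Primitive v) where

  Match : ℤ → ℤ → Set a
  Match x y = ∃ λ l → at u x ≡ just l × at v y ≡ just l

  -- Length 0 is allowed because cutting a leg may leave nothing of it.
  record Leg (x y x′ y′ : ℤ) : Set a where
    field
      σ τ     : Sign
      len     : ℕ
      end-x   : x′ ≡ x ⟨ σ ⟩ len
      end-y   : y′ ≡ y ⟨ τ ⟩ len
      matches : ∀ i → i ≤ len → Match (x ⟨ σ ⟩ i) (y ⟨ τ ⟩ i)

  open Leg

  -- Only the start is an index, so a move that changes the far end can still be made behind other
  -- legs.
  data Path (x y : ℤ) : Set a where
    stop : Match x y → Path x y
    _◂_  : ∀ {x′ y′} → Leg x y x′ y′ → Path x′ y′ → Path x y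

  infixr 5 _◂_

  -- Each leg counts one more than its length, so that merging two legs or dropping one of length 0
  -- also decreases the size.
  size : ∀ {x y} → Path x y → ℕ
  size (stop _) = 0
  size (s ◂ P)  = suc (len s) + size P

  data Side : Set where
    ofᵘ ofᵛ : Sign → Side

  -- The given direction leaves the word here.
  Hit : Side → ℤ → ℤ → Set a
  Hit (ofᵘ ρ) x y = at u (x ⟨ ρ ⟩ 1) ≡ nothing
  Hit (ofᵛ ρ) x y = at v (y ⟨ ρ ⟩ 1) ≡ nothing

  Corner : (ℤ → ℤ → Set a) → ∀ {x y} → Path x y → Set a
  Corner T {x} {y} (stop _) = T x y
  Corner T {x} {y} (s ◂ P)  = T x y ⊎ Corner T P

  corner-start : ∀ T {x y} (P : Path x y) → T x y → Corner T P
  corner-start T (stop _) t = t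
  corner-start T (s ◂ P)  t = inj₁ t

  infix 4 _≺_

  record _≺_ {x y x′ y′} (Q : Path x y) (P : Path x′ y′) : Set a where
    constructor shorter
    field
      smaller : size Q < size P
      hits    : ∀ S → Corner (Hit S) P → Corner (Hit S) Q

  -- The moves that keep the start, hence remain possible after a leg is put in front.
  Shrinks : ∀ {x y} → Path x y → Set a
  Shrinks {x} {y} P = Σ (Path x y) (_≺ P)

  shrinks-◂ : ∀ {x y x′ y′} (s : Leg x y x′ y′) {P : Path x′ y′} → Shrinks P → Shrinks (s ◂ P)
  shrinks-◂ s (Q , shorter smaller hits) = s ◂ Q , shorter (+-monoʳ-< (suc (len s)) smaller) λ S → map₂ (hits S)

  module _ {x y x′ y′} (s : Leg x y x′ y′) where

    backward : ∀ i → i ≤ len s → Match (x′ ⟨ opposite (σ s) ⟩ i) (y′ ⟨ opposite (τ s) ⟩ i)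
    backward i i≤len with m≤n⇒∃[o]m+o≡n i≤len
    ... | k , i+k≡len = subst₂ Match (eq (σ s) (end-x s)) (eq (τ s) (end-y s)) (matches s k (subst (k ≤_) i+k≡len (m≤n+m k i)))
      where
      eq : ∀ r {z z′} → z′ ≡ z ⟨ r ⟩ len s → z ⟨ r ⟩ k ≡ z′ ⟨ opposite r ⟩ i
      eq r {z} refl = sym (trans (cong (λ n → z ⟨ r ⟩ n ⟨ opposite r ⟩ i) (trans (sym i+k≡len) (+-comm i k))) (move-back-+ z r k i))

    match-end : Match x′ y′
    match-end = subst₂ Match (move-0 x′ (opposite (σ s))) (move-0 y′ (opposite (τ s))) (backward 0 z≤n)

    module _ {p} (p≤len : p ≤ len s) where

      private
        shift : ∀ r {z z′} → z′ ≡ z ⟨ r ⟩ len s → z ⟨ r ⟩ (len s ∸ p) ≡ z′ ⟨ opposite r ⟩ p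
        shift r {z} refl = sym (trans (cong (λ n → z ⟨ r ⟩ n ⟨ opposite r ⟩ p) (sym (m∸n+n≡m p≤len))) (move-back-+ z r _ p))

      take-leg : Leg x y (x ⟨ σ s ⟩ p) (y ⟨ τ s ⟩ p)
      take-leg = record { σ = σ s ; τ = τ s ; len = p ; end-x = refl ; end-y = refl
                        ; matches = λ i i≤p → matches s i (≤-trans i≤p p≤len) }

      drop-leg : Leg (x ⟨ σ s ⟩ p) (y ⟨ τ s ⟩ p) x′ y′
      drop-leg = record { σ = σ s ; τ = τ s ; len = len s ∸ p ; end-x = eq (σ s) (end-x s) ; end-y = eq (τ s) (end-y s)
                        ; matches = λ i i≤ → subst₂ Match (move-+ x (σ s) p i) (move-+ y (τ s) p i)
                            (matches s (p + i) (≤-trans (+-monoʳ-≤ p i≤) (≤-reflexive (m+[n∸m]≡n p≤len)))) }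
        where
        eq : ∀ r {z z′} → z′ ≡ z ⟨ r ⟩ len s → z′ ≡ z ⟨ r ⟩ p ⟨ r ⟩ (len s ∸ p)
        eq r {z} refl = trans (cong (z ⟨ r ⟩_) (sym (m+[n∸m]≡n p≤len))) (move-+ z r p _)

      take-leg-end : Leg x y (x′ ⟨ opposite (σ s) ⟩ p) (y′ ⟨ opposite (τ s) ⟩ p)
      take-leg-end = record { σ = σ s ; τ = τ s ; len = len s ∸ p
                            ; end-x = sym (shift (σ s) (end-x s)) ; end-y = sym (shift (τ s) (end-y s))
                            ; matches = λ i i≤ → matches s i (≤-trans i≤ (m∸n≤m (len s) p)) }

      drop-leg-end : Leg (x′ ⟨ opposite (σ s) ⟩ p) (y′ ⟨ opposite (τ s) ⟩ p) x′ y′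
      drop-leg-end = record { σ = σ s ; τ = τ s ; len = p
                            ; end-x = sym (move-forth x′ (σ s) p) ; end-y = sym (move-forth y′ (τ s) p)
                            ; matches = λ i i≤p → subst₂ Match
                                (trans (move-+ x (σ s) (len s ∸ p) i) (cong (_⟨ σ s ⟩ i) (shift (σ s) (end-x s))))
                                (trans (move-+ y (τ s) (len s ∸ p) i) (cong (_⟨ τ s ⟩ i) (shift (τ s) (end-y s))))
                                (matches s (len s ∸ p + i) (≤-trans (+-monoʳ-≤ (len s ∸ p) i≤p) (≤-reflexive (m∸n+n≡m p≤len)))) }

  -- Moves that shorten a path

  zero-leg : ∀ {x y x′ y′} (s : Leg x y x′ y′) → len s ≡ 0 → x′ ≡ x × y′ ≡ y
  zero-leg s len≡0 = trans (end-x s) (trans (cong (_ ⟨ σ s ⟩_) len≡0) (move-0 _ (σ s)))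
                   , trans (end-y s) (trans (cong (_ ⟨ τ s ⟩_) len≡0) (move-0 _ (τ s)))

  drop-zero : ∀ {x y x′ y′} (s : Leg x y x′ y′) (P : Path x′ y′) → len s ≡ 0 → Shrinks (s ◂ P)
  drop-zero s P len≡0 with zero-leg s len≡0
  ... | refl , refl = P , shorter (s≤s (m≤n+m (size P) (len s))) λ { S (inj₁ t) → corner-start (Hit S) P t ; S (inj₂ c) → c }

  Turns : ∀ {x y x′ y′ x″ y″} → Leg x y x′ y′ → Leg x′ y′ x″ y″ → Set
  Turns s t = σ t ≡ opposite (σ s) ⊎ τ t ≡ opposite (τ s)

  straight-or-turns : ∀ {x y x′ y′ x″ y″} (s : Leg x y x′ y′) (t : Leg x′ y′ x″ y″) →
                      (σ t ≡ σ s × τ t ≡ τ s) ⊎ Turns s t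
  straight-or-turns s t with same-or-opposite (σ s) (σ t) | same-or-opposite (τ s) (τ t)
  ... | inj₁ p | inj₁ q = inj₁ (p , q)
  ... | inj₂ p | _      = inj₂ (inj₁ p)
  ... | inj₁ _ | inj₂ q = inj₂ (inj₂ q)

  -- The word that turns reads the same letters on both legs, so the other one reads a palindrome.
  mirrors : ∀ {x y x′ y′ x″ y″} (s : Leg x y x′ y′) (t : Leg x′ y′ x″ y″) → Turns s t → ∀ {p} → p ≤ len s → p ≤ len t →
            Mirror u x′ (opposite (σ s)) (σ t) p × Mirror v y′ (opposite (τ s)) (τ t) p
  mirrors {x′ = x′} {y′} s t turns {p} p≤s p≤t = mirror (λ i i≤p → proj₁ (at-distance i i≤p)) , mirror (λ i i≤p → proj₂ (at-distance i i≤p))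
    where
    combine : ∀ {x₁ y₁ x₂ y₂} → x₂ ≡ x₁ ⊎ y₂ ≡ y₁ → Match x₁ y₁ → Match x₂ y₂ →
              (∃ λ l → at u x₁ ≡ just l × at u x₂ ≡ just l) × (∃ λ l → at v y₁ ≡ just l × at v y₂ ≡ just l)
    combine (inj₁ refl) (_ , p , q) (_ , p′ , q′) with just-injective (trans (sym p) p′)
    ... | refl = (_ , p , p′) , (_ , q , q′)
    combine (inj₂ refl) (_ , p , q) (_ , p′ , q′) with just-injective (trans (sym q) q′)
    ... | refl = (_ , p , p′) , (_ , q , q′)
    same-position : ∀ i → Turns s t →
      x′ ⟨ σ t ⟩ i ≡ x′ ⟨ opposite (σ s) ⟩ i ⊎ y′ ⟨ τ t ⟩ i ≡ y′ ⟨ opposite (τ s) ⟩ i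
    same-position i (inj₁ eq) = inj₁ (cong (x′ ⟨_⟩ i) eq)
    same-position i (inj₂ eq) = inj₂ (cong (y′ ⟨_⟩ i) eq)
    at-distance : ∀ i → i ≤ p →
      (∃ λ l → at u (x′ ⟨ opposite (σ s) ⟩ i) ≡ just l × at u (x′ ⟨ σ t ⟩ i) ≡ just l) ×
      (∃ λ l → at v (y′ ⟨ opposite (τ s) ⟩ i) ≡ just l × at v (y′ ⟨ τ t ⟩ i) ≡ just l)
    at-distance i i≤p = combine (same-position i turns) (backward s i (≤-trans i≤p p≤s)) (matches t i (≤-trans i≤p p≤t))

  hit-mirror : ∀ {x y r₁ r₂ q₁ q₂ p} → 1 ≤ p → Mirror u x r₁ r₂ p → Mirror v y q₁ q₂ p → ∀ S →
               Hit S (x ⟨ r₁ ⟩ p) (y ⟨ q₁ ⟩ p) → Hit S (x ⟨ r₂ ⟩ p) (y ⟨ q₂ ⟩ p)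
  hit-mirror 1≤p mᵘ mᵛ (ofᵘ ρ) = mirror-end u primᵘ _ _ _ _ 1≤p mᵘ ρ
  hit-mirror 1≤p mᵘ mᵛ (ofᵛ ρ) = mirror-end v primᵛ _ _ _ _ 1≤p mᵛ ρ

  ¬hit-forward : ∀ {x y x′ y′} (s : Leg x y x′ y′) → 1 ≤ len s → (Hit (ofᵘ (σ s)) x y → ⊥) × (Hit (ofᵛ (τ s)) x y → ⊥)
  ¬hit-forward s 1≤len with matches s 1 1≤len
  ... | _ , p , q = just≢nothing p , just≢nothing q

  ¬hit-backward : ∀ {x y x′ y′} (s : Leg x y x′ y′) → 1 ≤ len s →
                  (Hit (ofᵘ (opposite (σ s))) x′ y′ → ⊥) × (Hit (ofᵛ (opposite (τ s))) x′ y′ → ⊥)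
  ¬hit-backward s 1≤len with backward s 1 1≤len
  ... | _ , p , q = just≢nothing p , just≢nothing q

  -- In either direction of either word, the neighbour of the dropped corner lies on one of the two
  -- legs, so no side is hit there.
  merge : ∀ {x y x′ y′ x″ y″} (s : Leg x y x′ y′) (t : Leg x′ y′ x″ y″) (P : Path x″ y″) →
          σ t ≡ σ s × τ t ≡ τ s → 1 ≤ len s → 1 ≤ len t → Shrinks (s ◂ t ◂ P)
  merge {x} {y} {x′} {y′} {x″} {y″} s t P (σ≡ , τ≡) 1≤s 1≤t = st ◂ P , shorter smaller hits
    where
    along : ∀ {r q} {z z′} → q ≡ r → z′ ≡ z ⟨ r ⟩ len s → ∀ i → z′ ⟨ q ⟩ i ≡ z ⟨ r ⟩ (len s + i)
    along {r} {z = z} refl refl i = sym (move-+ z r (len s) i)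
    st : Leg x y x″ y″
    st = record { σ = σ s ; τ = τ s ; len = len s + len t
                ; end-x = trans (end-x t) (along σ≡ (end-x s) (len t))
                ; end-y = trans (end-y t) (along τ≡ (end-y s) (len t))
                ; matches = all-match }
      where
      all-match : ∀ i → i ≤ len s + len t → Match (x ⟨ σ s ⟩ i) (y ⟨ τ s ⟩ i)
      all-match i i≤ with ≤-total i (len s)
      ... | inj₁ i≤s = matches s i i≤s
      ... | inj₂ s≤i with m≤n⇒∃[o]m+o≡n s≤i
      ... | k , refl = subst₂ Match (along σ≡ (end-x s) k) (along τ≡ (end-y s) k) (matches t k (+-cancelˡ-≤ (len s) k (len t) i≤))
    smaller : suc (len s + len t) + size P < suc (len s) + (suc (len t) + size P)
    smaller = s≤s (≤-reflexive (trans (cong suc (+-assoc (len s) (len t) (size P))) (sym (+-suc (len s) _))))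
    ¬hit : ∀ S → Hit S x′ y′ → ⊥
    ¬hit (ofᵘ ρ) h with same-or-opposite (σ s) ρ
    ... | inj₁ refl = proj₁ (¬hit-forward t 1≤t) (subst (λ r → Hit (ofᵘ r) x′ y′) (sym σ≡) h)
    ... | inj₂ refl = proj₁ (¬hit-backward s 1≤s) h
    ¬hit (ofᵛ ρ) h with same-or-opposite (τ s) ρ
    ... | inj₁ refl = proj₂ (¬hit-forward t 1≤t) (subst (λ r → Hit (ofᵛ r) x′ y′) (sym τ≡) h)
    ... | inj₂ refl = proj₂ (¬hit-backward s 1≤s) h
    hits : ∀ S → Corner (Hit S) (s ◂ t ◂ P) → Corner (Hit S) (st ◂ P)
    hits S (inj₁ h)        = inj₁ h
    hits S (inj₂ (inj₁ h)) = ⊥-elim (¬hit S h)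
    hits S (inj₂ (inj₂ c)) = inj₂ c

  -- The path now starts at the end of `s`. The second leg is cut at distance `len s`, because this
  -- point is the mirror image of the lost start and hits whatever the start hit.
  fold-first : ∀ {x y x′ y′ x″ y″} (s : Leg x y x′ y′) (t : Leg x′ y′ x″ y″) (P : Path x″ y″) → Turns s t →
               1 ≤ len s → len s ≤ len t → Σ (Path x′ y′) (_≺ (s ◂ t ◂ P))
  fold-first {x} {y} {x′} {y′} s t P turns 1≤s s≤t = take-leg t s≤t ◂ drop-leg t s≤t ◂ P
    , shorter (+-monoʳ-< (suc (len s)) (+-monoˡ-< (size P) (s≤s (∸-monoʳ-< 1≤s s≤t)))) hits
    where
    hit-start : ∀ S → Hit S x y → Hit S (x′ ⟨ σ t ⟩ len s) (y′ ⟨ τ t ⟩ len s)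
    hit-start S h with mirrors s t turns ≤-refl s≤t
    ... | mᵘ , mᵛ = hit-mirror 1≤s mᵘ mᵛ S (subst₂ (Hit S) (start (σ s) (end-x s)) (start (τ s) (end-y s)) h)
      where
      start : ∀ r {z z′} → z′ ≡ z ⟨ r ⟩ len s → z ≡ z′ ⟨ opposite r ⟩ len s
      start r refl = sym (move-back _ r _)
    hits : ∀ S → Corner (Hit S) (s ◂ t ◂ P) → Corner (Hit S) (take-leg t s≤t ◂ drop-leg t s≤t ◂ P)
    hits S (inj₁ h)               = inj₂ (inj₁ (hit-start S h))
    hits S (inj₂ (inj₁ h))        = inj₁ h
    hits S (inj₂ (inj₂ c))        = inj₂ (inj₂ c)

  -- The lost end is replaced by its mirror image on `s`, at distance `len t` before the end of `s`.
  fold-last : ∀ {x y x′ y′ x″ y″} (s : Leg x y x′ y′) (t : Leg x′ y′ x″ y″) (m : Match x″ y″) → Turns s t →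
              1 ≤ len t → len t ≤ len s → Shrinks (s ◂ t ◂ stop m)
  fold-last {x} {y} {x′} {y′} {x″} {y″} s t m turns 1≤t t≤s = take-leg-end s t≤s ◂ drop-leg-end s t≤s ◂ stop (match-end s)
    , shorter (+-monoˡ-< (suc (len t) + 0) (s≤s (∸-monoʳ-< 1≤t t≤s))) hits
    where
    hit-end : ∀ S → Hit S x″ y″ → Hit S (x′ ⟨ opposite (σ s) ⟩ len t) (y′ ⟨ opposite (τ s) ⟩ len t)
    hit-end S h with mirrors s t turns t≤s ≤-refl
    ... | mᵘ , mᵛ = hit-mirror 1≤t (mirror-sym mᵘ) (mirror-sym mᵛ) S (subst₂ (Hit S) (end-x t) (end-y t) h)
    hits : ∀ S → Corner (Hit S) (s ◂ t ◂ stop m) → Corner (Hit S) (take-leg-end s t≤s ◂ drop-leg-end s t≤s ◂ stop (match-end s))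
    hits S (inj₁ h)        = inj₁ h
    hits S (inj₂ (inj₁ h)) = inj₂ (inj₂ h)
    hits S (inj₂ (inj₂ h)) = inj₂ (inj₁ (hit-end S h))

  -- `bridge` applies to each word separately; both shortcuts read the last stretch of `s`, so their
  -- letters match. The lost corners reappear crosswise: the start of `t`, mirrored in its end, is
  -- the end of the shortcut, and the end of `t`, mirrored in its start, is the start of the
  -- shortcut.
  shortcut : ∀ {x y x′ y′ x″ y″ x‴ y‴} (s : Leg x y x′ y′) (t : Leg x′ y′ x″ y″) (r : Leg x″ y″ x‴ y‴) (P : Path x‴ y‴) →
             Turns s t → Turns t r → 1 ≤ len t → len t ≤ len s → len t ≤ len r → Shrinks (s ◂ t ◂ r ◂ P)
  shortcut {x} {y} {x′} {y′} {x″} {y″} s t r P turns₁ turns₂ 1≤t t≤s t≤r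
    with mirrors s t turns₁ t≤s ≤-refl | mirrors t r turns₂ ≤-refl t≤r
  ... | mᵘ₁ , mᵛ₁ | mᵘ₂ , mᵛ₂
    with bridge u primᵘ _ _ _ _ _ _ 1≤t (end-x t) mᵘ₁ mᵘ₂ | bridge v primᵛ _ _ _ _ _ _ 1≤t (end-y t) mᵛ₁ mᵛ₂
  ... | σ′ , ex , lᵘ | τ′ , ey , lᵛ = take-leg-end s t≤s ◂ t′ ◂ drop-leg r t≤r ◂ P , shorter smaller hits
    where
    t′ : Leg (x′ ⟨ opposite (σ s) ⟩ len t) (y′ ⟨ opposite (τ s) ⟩ len t) (x″ ⟨ σ r ⟩ len t) (y″ ⟨ τ r ⟩ len t)
    t′ = record { σ = σ′ ; τ = τ′ ; len = len t ; end-x = ex ; end-y = ey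
                ; matches = λ i i≤ → let l , p , q = matches (drop-leg-end s t≤s) i i≤ in
                    l , trans (lᵘ i i≤) p , trans (lᵛ i i≤) q }
    smaller : suc (len s ∸ len t) + (suc (len t) + (suc (len r ∸ len t) + size P)) < suc (len s) + (suc (len t) + (suc (len r) + size P))
    smaller = +-mono-<-≤ (s≤s (∸-monoʳ-< 1≤t t≤s)) (+-monoʳ-≤ (suc (len t)) (+-monoˡ-≤ (size P) (s≤s (m∸n≤m (len r) (len t)))))
    start : ∀ q {z z′} → z′ ≡ z ⟨ q ⟩ len t → z ≡ z′ ⟨ opposite q ⟩ len t
    start q refl = sym (move-back _ q _)
    hits : ∀ S → Corner (Hit S) (s ◂ t ◂ r ◂ P) → Corner (Hit S) (take-leg-end s t≤s ◂ t′ ◂ drop-leg r t≤r ◂ P)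
    hits S (inj₁ h)               = inj₁ h
    hits S (inj₂ (inj₁ h))        = inj₂ (inj₂ (inj₁ (hit-mirror 1≤t mᵘ₂ mᵛ₂ S
      (subst₂ (Hit S) (start (σ t) (end-x t)) (start (τ t) (end-y t)) h))))
    hits S (inj₂ (inj₂ (inj₁ h))) = inj₂ (inj₁ (hit-mirror 1≤t (mirror-sym mᵘ₁) (mirror-sym mᵛ₁) S
      (subst₂ (Hit S) (end-x t) (end-y t) h)))
    hits S (inj₂ (inj₂ (inj₂ c))) = inj₂ (inj₂ (inj₂ c))

  -- Walk along decreasing leg lengths until the next leg is at least as long, or there is none.
  shrink-descending : ∀ {x y x′ y′ x″ y″} (s : Leg x y x′ y′) (t : Leg x′ y′ x″ y″) (P : Path x″ y″) →
                      len t < len s → Shrinks (s ◂ t ◂ P)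
  shrink-descending s t P t<s with len t in len≡
  ... | zero = shrinks-◂ s (drop-zero t P len≡)
  ... | suc _ with straight-or-turns s t
  ... | inj₁ eqs = merge s t P eqs (≤-trans z<s t<s) (subst (1 ≤_) (sym len≡) z<s)
  ... | inj₂ turns₁ = next P
    where
    1≤t : 1 ≤ len t
    1≤t = subst (1 ≤_) (sym len≡) z<s
    t≤s : len t ≤ len s
    t≤s = subst (_≤ len s) (sym len≡) (<⇒≤ t<s)
    next : ∀ P → Shrinks (s ◂ t ◂ P)
    next (stop m) = fold-last s t m turns₁ 1≤t t≤s
    next (r ◂ P) with ≤-<-connex (len t) (len r)
    ... | inj₂ r<t = shrinks-◂ s (shrink-descending t r P r<t)
    ... | inj₁ t≤r with straight-or-turns t r
    ...   | inj₁ eqs    = shrinks-◂ s (merge t r P eqs 1≤t (≤-trans 1≤t t≤r))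
    ...   | inj₂ turns₂ = shortcut s t r P turns₁ turns₂ 1≤t t≤s t≤r

  -- A first leg no longer than the second is itself locally minimal and is folded unless it is
  -- empty or runs straight on; otherwise the lengths descend. Folding it moves the start, hence the
  -- existential.
  shrink : ∀ {x y x′ y′ x″ y″} (s : Leg x y x′ y′) (t : Leg x′ y′ x″ y″) (P : Path x″ y″) →
           ∃ λ x₀ → ∃ λ y₀ → Σ (Path x₀ y₀) (_≺ (s ◂ t ◂ P))
  shrink s t P with ≤-<-connex (len s) (len t)
  ... | inj₂ t<s = _ , _ , shrink-descending s t P t<s
  ... | inj₁ s≤t with len s in len≡
  ... | zero = _ , _ , drop-zero s (t ◂ P) len≡
  ... | suc _ with straight-or-turns s t
  ... | inj₁ eqs   = _ , _ , merge s t P eqs (subst (1 ≤_) (sym len≡) z<s) (≤-trans z<s s≤t)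
  ... | inj₂ turns = _ , _ , fold-first s t P turns (subst (1 ≤_) (sym len≡) z<s) (subst (_≤ len t) (sym len≡) s≤t)

  -- Reduction to a single leg

  record Diagonal : Set a where
    field
      {x y x′ y′} : ℤ
      leg         : Leg x y x′ y′
      hits        : ∀ S → Hit S x y ⊎ Hit S x′ y′

  straighten : ∀ n {x y} (P : Path x y) → size P < n → (∀ S → Corner (Hit S) P) → Diagonal
  -- A path without legs is taken as a leg of length 0 with arbitrary directions.
  straighten n {x} {y} (stop m) _ hits = record { leg = point ; hits = λ S → inj₁ (hits S) }
    where
    point : Leg x y x y
    point = record { σ = Sign.+ ; τ = Sign.+ ; len = 0
                   ; end-x = sym (move-0 x Sign.+) ; end-y = sym (move-0 y Sign.+)
                   ; matches = λ { zero _ → subst₂ Match (sym (move-0 x Sign.+)) (sym (move-0 y Sign.+)) m } }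
  straighten n (s ◂ stop _) _ hits = record { leg = s ; hits = hits }
  straighten (suc n) (s ◂ t ◂ P) (s≤s size≤n) hits with shrink s t P
  ... | _ , _ , Q , shorter smaller keeps = straighten n Q (≤-trans smaller size≤n) λ S → keeps S (hits S)

-- From walks to paths and back

atℕ-++ˡ : (xs ys : List A) {i : ℕ} → i < length xs → atℕ (xs ++ ys) i ≡ atℕ xs i
atℕ-++ˡ (x ∷ xs) ys {zero}  _         = refl
atℕ-++ˡ (x ∷ xs) ys {suc i} (s≤s i<) = atℕ-++ˡ xs ys i<

atℕ-∷ʳ-length : (xs : List A) (x : A) → atℕ (xs ++ [ x ]) (length xs) ≡ just x
atℕ-∷ʳ-length []       x = refl
atℕ-∷ʳ-length (_ ∷ xs) x = atℕ-∷ʳ-length xs x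

atℕ-reverse : (xs : List A) (i j : ℕ) → length xs ≡ suc (i + j) → atℕ (reverse xs) i ≡ atℕ xs j
atℕ-reverse (x ∷ xs) i zero    len≡ rewrite unfold-reverse x xs =
  trans (cong (atℕ (reverse xs ++ [ x ])) (trans (sym (+-identityʳ i)) (trans (sym (suc-injective len≡)) (sym (length-reverse xs)))))
        (atℕ-∷ʳ-length (reverse xs) x)
atℕ-reverse (x ∷ xs) i (suc j) len≡ rewrite unfold-reverse x xs =
  trans (atℕ-++ˡ (reverse xs) [ x ] (subst (i <_) (sym (trans (length-reverse xs) len≡′)) (s≤s (m≤m+n i j))))
        (atℕ-reverse xs i j len≡′)
  where
  len≡′ : length xs ≡ suc (i + j)
  len≡′ = trans (suc-injective len≡) (+-suc i j)

atℕ-ext : (xs ys : List A) → length xs ≡ length ys → (∀ i → i < length xs → atℕ xs i ≡ atℕ ys i) → xs ≡ ys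
atℕ-ext []       []       _    _  = refl
atℕ-ext (x ∷ xs) (y ∷ ys) len≡ eq =
  cong₂ _∷_ (just-injective (eq 0 z<s)) (atℕ-ext xs ys (suc-injective len≡) λ i i< → eq (suc i) (s≤s i<))

orient : Sign → List A → List A
orient Sign.+ w = w
orient Sign.- w = reverse w

private
  not-before : (w : List A) (i : ℕ) {l : A} → atℕ w i ≡ just l → at w (+ i ⟨ Sign.- ⟩ 1) ≡ nothing → i ≡ 0
  not-before w zero    _ _   = refl
  not-before w (suc i) e end = ⊥-elim (<⇒≱ (≤-trans (n≤1+n _) (atℕ-just⇒< w (suc i) e)) (atℕ-nothing⇒≥ w i end))

  not-after : (w : List A) (i : ℕ) {l : A} → atℕ w i ≡ just l → at w (+ i ⟨ Sign.+ ⟩ 1) ≡ nothing → length w ≡ suc i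
  not-after w i e end = ≤-antisym (subst (length w ≤_) (+-comm i 1) (atℕ-nothing⇒≥ w (i + 1) end)) (atℕ-just⇒< w i e)

-- The `nothing` before and after pins the ends of the leg to the ends of the word; `s` decides
-- whether it is read forwards or backwards.
traversal : (w : List A) (x : ℤ) (s : Sign) (p : ℕ) → (∀ i → i ≤ p → ∃ λ l → at w (x ⟨ s ⟩ i) ≡ just l) →
            at w (x ⟨ opposite s ⟩ 1) ≡ nothing → at w (x ⟨ s ⟩ p ⟨ s ⟩ 1) ≡ nothing →
            length (orient s w) ≡ suc p × (∀ i → i ≤ p → atℕ (orient s w) i ≡ at w (x ⟨ s ⟩ i))
traversal w x Sign.+ p inside before after with inside 0 z≤n
... | _ , e₀ with at-just⇒ℕ w x (trans (cong (at w) (sym (move-0 x Sign.+))) e₀)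
... | k , refl , _ rewrite +-identityʳ k with not-before w k e₀ before
... | refl = not-after w p (proj₂ (inside p ≤-refl)) after , λ _ _ → refl
traversal w x Sign.- p inside before after with inside p ≤-refl | inside 0 z≤n
... | _ , eₚ | _ , e₀ with at-just⇒ℕ w (x ⟨ Sign.- ⟩ p) eₚ
... | j , x-p≡j , _ with not-before w j (trans (cong (at w) (sym x-p≡j)) eₚ) (trans (cong (λ z → at w (z ⟨ Sign.- ⟩ 1)) (sym x-p≡j)) after)
... | refl with trans (sym (move-back x Sign.- p)) (cong (_⟨ Sign.+ ⟩ p) x-p≡j)
... | refl = trans (length-reverse w) len≡ , letters
  where
  len≡ : length w ≡ suc p
  len≡ = not-after w p (trans (cong (at w) (sym (move-0 (+ p) Sign.-))) e₀) before
  letters : ∀ i → i ≤ p → atℕ (reverse w) i ≡ at w (+ p ⟨ Sign.- ⟩ i)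
  letters i i≤p with m≤n⇒∃[o]m+o≡n i≤p
  ... | k , refl = trans (atℕ-reverse w i k len≡)
    (cong (at w) (sym (trans (cong (λ n → + n ⟨ Sign.- ⟩ i) (+-comm i k)) (move-back (+ k) Sign.+ i))))

orient-unique : (u v : List A) (σ τ : Sign) → orient σ u ≡ orient τ v → u ≡ v ⊎ u ≡ reverse v
orient-unique u v Sign.+ Sign.+ eq = inj₁ eq
orient-unique u v Sign.+ Sign.- eq = inj₂ eq
orient-unique u v Sign.- Sign.+ eq = inj₂ (trans (sym (reverse-involutive u)) (cong reverse eq))
orient-unique u v Sign.- Sign.- eq = inj₁ (reverse-injective eq)

-- Steps of walks and the extreme positions they reach

Near : ℤ → ℤ → Set
Near x x′ = x′ ≡ x ⊎ ∃ λ s → x′ ≡ x ⟨ s ⟩ 1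

∣x′-x∣≤1⇒near : ∀ x x′ → ∣ x′ -ℤ x ∣ ≤ 1 → Near x x′
∣x′-x∣≤1⇒near x x′ d≤1 = go (x′ -ℤ x) d≤1 (recover x x′)
  where
  recover : ∀ x x′ → x′ ≡ x +ℤ (x′ -ℤ x)
  recover = ℤ-Solver.solve-∀
  go : ∀ z → ∣ z ∣ ≤ 1 → x′ ≡ x +ℤ z → Near x x′
  go (+ 0)      _ eq = inj₁ (trans eq (move-0 x Sign.+))
  go (+ 1)      _ eq = inj₂ (Sign.+ , eq)
  go (+ suc (suc _)) (s≤s ()) _
  go -[1+ 0 ]   _ eq = inj₂ (Sign.- , eq)
  go -[1+ suc _ ] (s≤s ()) _

tabulate-injective : ∀ {n} (f g : Fin n → A) → tabulate f ≡ tabulate g → ∀ i → f i ≡ g i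
tabulate-injective f g eq zero    = ∷-injectiveˡ eq
tabulate-injective f g eq (suc i) = tabulate-injective (λ j → f (suc j)) (λ j → g (suc j)) (∷-injectiveʳ eq) i

tabulate-length : ∀ {m n} (f : Fin m → A) (g : Fin n → A) → tabulate f ≡ tabulate g → m ≡ n
tabulate-length f g eq = trans (sym (length-tabulate f)) (trans (cong length eq) (length-tabulate g))

-- Surjectivity supplies a time at which the walk stands on the first or last letter, according to
-- `ρ`.
reaches-end : ∀ {m} (w : List A) (h : Fin (suc m) → Fin (length w)) → Surjective _≡_ _≡_ h →
              ∀ ρ → ∃ λ i → at w (+ toℕ (h i) ⟨ ρ ⟩ 1) ≡ nothing
reaches-end [] h surj ρ with h zero
... | ()
reaches-end (l ∷ w) h surj Sign.- with surj zero
... | i , hi≡ = i , cong (λ z → at (l ∷ w) (+ toℕ z ⟨ Sign.- ⟩ 1)) (hi≡ refl)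
reaches-end (l ∷ w) h surj Sign.+ with surj (fromℕ (length w))
... | i , hi≡ = i , trans (cong (λ z → at (l ∷ w) (+ toℕ z ⟨ Sign.+ ⟩ 1)) (hi≡ refl))
  (atℕ-≥ (l ∷ w) (≤-reflexive (trans (cong suc (sym (toℕ-fromℕ (length w)))) (+-comm 1 _))))

module _ {A : Set a} (u v : List A) (primᵘ : Primitive u) (primᵛ : Primitive v) where

  open Grid u v primᵘ primᵛ
  open Leg

  -- A step moving only one of the two positions would repeat a letter in that word.
  prepend : ∀ {x y x′ y′} (P : Path x′ y′) → Near x x′ → Near y y′ → Match x y → Match x′ y′ →
            Σ (Path x y) λ Q → ∀ T → T x y ⊎ Corner T P → Corner T Q
  prepend P (inj₁ refl) (inj₁ refl) _ _ = P , λ { T (inj₁ t) → corner-start T P t ; T (inj₂ c) → c }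
  prepend P (inj₁ refl) (inj₂ (s , refl)) (_ , p , q) (_ , p′ , q′) with just-injective (trans (sym p) p′)
  ... | refl = ⊥-elim (no-repeat v primᵛ _ s q q′)
  prepend P (inj₂ (s , refl)) (inj₁ refl) (_ , p , q) (_ , p′ , q′) with just-injective (trans (sym q) q′)
  ... | refl = ⊥-elim (no-repeat u primᵘ _ s p p′)
  prepend {x} {y} P (inj₂ (s , refl)) (inj₂ (t , refl)) m m′ = step ◂ P , λ _ → id
    where
    step-matches : ∀ i → i ≤ 1 → Match (x ⟨ s ⟩ i) (y ⟨ t ⟩ i)
    step-matches 0 _ = subst₂ Match (sym (move-0 x s)) (sym (move-0 y t)) m
    step-matches 1 _ = m′
    step-matches (suc (suc _)) (s≤s ())
    step : Leg x y (x ⟨ s ⟩ 1) (y ⟨ t ⟩ 1)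
    step = record { σ = s ; τ = t ; len = 1 ; end-x = refl ; end-y = refl ; matches = step-matches }

  -- A step becomes a leg of length 1, or nothing if both walks pause, so every visited point is a
  -- corner.
  walks⇒path : ∀ m (f g : Fin (suc m) → ℤ) → (∀ i → Match (f i) (g i)) →
               (∀ i → Near (f (inject₁ i)) (f (suc i))) → (∀ i → Near (g (inject₁ i)) (g (suc i))) →
               Σ (Path (f zero) (g zero)) λ P → ∀ T i → T (f i) (g i) → Corner T P
  walks⇒path zero    f g match nearᶠ nearᵍ = stop (match zero) , λ { T zero t → t }
  walks⇒path (suc m) f g match nearᶠ nearᵍ
    with walks⇒path m (λ i → f (suc i)) (λ i → g (suc i)) (λ i → match (suc i)) (λ i → nearᶠ (suc i)) (λ i → nearᵍ (suc i))
  ... | P , corners with prepend P (nearᶠ zero) (nearᵍ zero) (match zero) (match (suc zero))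
  ... | Q , keeps = Q , λ { T zero t → keeps T (inj₁ t) ; T (suc i) t → keeps T (inj₂ (corners T i t)) }

  -- A leg of positive length hits no side ahead of it at its start and none behind it at its end;
  -- for length 0 the two ends coincide. So it begins and stops at ends of both words.
  diagonal⇒unique : Diagonal → u ≡ v ⊎ u ≡ reverse v
  diagonal⇒unique D = orient-unique u v (σ leg) (τ leg)
      (atℕ-ext _ _ (trans lenᵘ (sym lenᵛ)) λ i i< → letters i (≤-pred (subst (i <_) lenᵘ i<)))
    where
    open Diagonal D
    at-end : ∀ S → (1 ≤ len leg → Hit S x y → ⊥) → Hit S x′ y′
    at-end S ¬start with hits S | len leg in len≡
    ... | inj₂ h | _     = h
    ... | inj₁ h | suc _ = ⊥-elim (¬start z<s h)
    ... | inj₁ h | zero with zero-leg leg len≡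
    ...   | refl , refl = h
    at-start : ∀ S → (1 ≤ len leg → Hit S x′ y′ → ⊥) → Hit S x y
    at-start S ¬end with hits S | len leg in len≡
    ... | inj₁ h | _     = h
    ... | inj₂ h | suc _ = ⊥-elim (¬end z<s h)
    ... | inj₂ h | zero with zero-leg leg len≡
    ...   | refl , refl = h
    inᵘ : length (orient (σ leg) u) ≡ suc (len leg) × (∀ i → i ≤ len leg → atℕ (orient (σ leg) u) i ≡ at u (x ⟨ σ leg ⟩ i))
    inᵘ = traversal u x (σ leg) (len leg) (λ i i≤ → let l , p , _ = matches leg i i≤ in l , p)
      (at-start (ofᵘ (opposite (σ leg))) λ 1≤ → proj₁ (¬hit-backward leg 1≤))
      (subst (λ z → at u (z ⟨ σ leg ⟩ 1) ≡ nothing) (end-x leg) (at-end (ofᵘ (σ leg)) λ 1≤ → proj₁ (¬hit-forward leg 1≤)))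
    inᵛ : length (orient (τ leg) v) ≡ suc (len leg) × (∀ i → i ≤ len leg → atℕ (orient (τ leg) v) i ≡ at v (y ⟨ τ leg ⟩ i))
    inᵛ = traversal v y (τ leg) (len leg) (λ i i≤ → let l , _ , q = matches leg i i≤ in l , q)
      (at-start (ofᵛ (opposite (τ leg))) λ 1≤ → proj₂ (¬hit-backward leg 1≤))
      (subst (λ z → at v (z ⟨ τ leg ⟩ 1) ≡ nothing) (end-y leg) (at-end (ofᵛ (τ leg)) λ 1≤ → proj₂ (¬hit-forward leg 1≤)))
    lenᵘ = proj₁ inᵘ
    lenᵛ = proj₁ inᵛ
    letters : ∀ i → i ≤ len leg → atℕ (orient (σ leg) u) i ≡ atℕ (orient (τ leg) v) i
    letters i i≤ = let _ , p , q = matches leg i i≤ in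
      trans (proj₂ inᵘ i i≤) (trans p (sym (trans (proj₂ inᵛ i i≤) q)))

  common-walk⇒unique : ∀ {m} (f : Fin (suc m) → Fin (length u)) (g : Fin (suc m) → Fin (length v)) → IsWalk f → IsWalk g →
                       (∀ i → lookup u (f i) ≡ lookup v (g i)) → u ≡ v ⊎ u ≡ reverse v
  common-walk⇒unique {m} f g (surjᶠ , stepsᶠ) (surjᵍ , stepsᵍ) letters
    with walks⇒path m (λ i → + toℕ (f i)) (λ i → + toℕ (g i)) match (near f stepsᶠ) (near g stepsᵍ)
    where
    match : ∀ i → Match (+ toℕ (f i)) (+ toℕ (g i))
    match i = lookup u (f i) , atℕ-lookup u (f i) , trans (atℕ-lookup v (g i)) (cong just (sym (letters i)))
    near : ∀ {n} (h : Fin (suc m) → Fin n) → Steps h → ∀ i → Near (+ toℕ (h (inject₁ i))) (+ toℕ (h (suc i)))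
    near h steps i = ∣x′-x∣≤1⇒near _ _ (steps (inject₁ i) (suc i) (cong suc (toℕ-inject₁ i)))
  ... | P , corners = diagonal⇒unique (straighten _ P ≤-refl λ
      { (ofᵘ ρ) → let i , h = reaches-end u f surjᶠ ρ in corners (Hit (ofᵘ ρ)) i h
      ; (ofᵛ ρ) → let i , h = reaches-end v g surjᵍ ρ in corners (Hit (ofᵛ ρ)) i h })

-- The empty word and the conclusion

no-positions : ∀ {n} (f : Fin 0 → Fin n) → IsWalk f → n ≡ 0
no-positions {zero}  f _ = refl
no-positions {suc n} f (surj , _) with surj zero
... | () , _

length≡0 : (w : List A) → length w ≡ 0 → w ≡ []
length≡0 [] _ = refl

theorem1 : ∀ {a : Level} {Σ : Set a} (w u v : List Σ) →
    PrimitiveGenerator u w → PrimitiveGenerator v w → (u ≡ v) ⊎ (u ≡ reverse v)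
theorem1 w u v (primᵘ , m , f , walkᶠ , w≡uᶠ) (primᵛ , m′ , g , walkᵍ , w≡vᵍ)
  with trans (sym w≡uᶠ) w≡vᵍ
... | uᶠ≡vᵍ with tabulate-length _ _ uᶠ≡vᵍ
... | refl with m
-- A walk without positions is onto only the empty word, so both generators are empty.
... | zero  = inj₁ (trans (length≡0 u (no-positions f walkᶠ)) (sym (length≡0 v (no-positions g walkᵍ))))
... | suc _ = common-walk⇒unique u v primᵘ primᵛ f g walkᶠ walkᵍ (tabulate-injective _ _ uᶠ≡vᵍ)
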